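{- For any desired $p = p(n)$ and $s = s(n) = O(n^{1/3})$ with $p \cdot s = \omega(n)$, there is an infinite family of $n$-node directed graphs $G = (V, E)$ together with sets $S \subseteq V$ with $|S| = s$ and sets $P \subseteq S \times V$ of $|P| = p$ node pairs, such that every reachability preserver of $G, P$ has $\omega(n)$ edges.
   Context: For a directed graph $G=(V,E)$ and a set of node pairs $P \subseteq V \times V$, a reachability preserver of $G,P$ is a subgraph $H=(V,E')$ with $E' \subseteq E$ such that for all $(s,t) \in P$, $H$ contains a directed path from $s$ to $t$ if and only if $G$ does. -}

module Defs where

open import Data.Nat using (ℕ; _*_; _^_; _≤_; _<_)
open import Data.Fin using (Fin)
open import Data.Product using (_×_; _,_; proj₁; Σ; ∃; ∃-syntax)
open import Data.List using (List; length)
open import Data.List.Membership.Propositional using (_∈_)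
open import Data.List.Relation.Unary.Unique.Propositional using (Unique)
open import Data.List.Relation.Unary.All using (All)
open import Function.Bundles using (_⇔_)
open import Relation.Binary.PropositionalEquality using (_≡_)

record Digraph (n : ℕ) : Set where
  constructor mkDigraph
  field
    edges  : List (Fin n × Fin n)
    unique : Unique edges
open Digraph public

data Reach {n : ℕ} (E : List (Fin n × Fin n)) : Fin n → Fin n → Set where
  here  : ∀ {u} → Reach E u u
  there : ∀ {u v w} → (u , v) ∈ E → Reach E v w → Reach E u w

_⊆ᴱ_ : ∀ {n} → Digraph n → Digraph n → Set
H ⊆ᴱ G = All (λ e → e ∈ edges G) (edges H)

IsReachabilityPreserver : ∀ {n} → Digraph n → List (Fin n × Fin n) → Digraph n → Set
IsReachabilityPreserver {n} G P H =
  H ⊆ᴱ G × (∀ (s t : Fin n) → (s , t) ∈ P → (Reach (edges H) s t ⇔ Reach (edges G) s t))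

∣E∣ : ∀ {n} → Digraph n → ℕ
∣E∣ H = length (edges H)

record Instance (n s p : ℕ) : Set where
  field
    G       : Digraph n
    S       : List (Fin n)
    S-uniq  : Unique S
    S-size  : length S ≡ s
    P       : List (Fin n × Fin n)
    P-uniq  : Unique P
    P-size  : length P ≡ p
    P⊆S×V   : All (λ st → proj₁ st ∈ S) P

module Submission where

-- A core node lies in one of q + 1 layers, each an integer grid, and a track in direction a < d
-- advances by the vector (d − a , a²) from layer to layer.  These vectors are in strictly
-- convex position: the functional y + 2ax is minimised among them exactly at direction a.
-- A source points to all track starts on one level line of that functional, so a walk from the
-- source to the end of a track cannot afford any other direction; hence it is unique, and
-- every hop of every track is forced into a preserver.  Grouping starts into level lines needs only
-- O(d³q) sources although there are Θ(d⁴q²) tracks, and disjoint copies of the core that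
-- share the sources fill up n nodes when n is much larger than s³.  With q ≈ s/(3d³) the forced hops
-- number Ω(dn), for any constant d; letting d grow along a sparse family of n gives ω(n).

open import Defs
open import Data.Nat using (ℕ; _*_; _^_; _≤_; _<_)
open import Data.Product using (_×_; Σ; ∃-syntax)
open import Data.Nat using (zero; suc; _+_; _∸_; _⊓_; _⊔_; z≤n; z<s; ∣_-_∣; NonZero; >-nonZero; >-nonZero⁻¹)
open import Data.Nat.DivMod using (_/_; _%_; m≡m%n+[m/n]*n; m%n<n; m/n*n≤m; m≥n⇒m/n>0)
open import Data.Nat.Properties
open import Data.Nat.Tactic.RingSolver using (solve-∀)
open import Data.Fin as Fin using (Fin; zero; suc; toℕ; fromℕ; fromℕ<; inject₁; inject≤; combine)
import Data.Fin.Properties as Finₚ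
open import Data.Product using (_,_; proj₁; proj₂)
open import Data.Product.Properties using (,-injective; ≡-dec)
open import Data.Product.Function.NonDependent.Propositional using (_×-↔_)
open import Data.Sum using (_⊎_; inj₁; inj₂)
open import Data.Sum.Function.Propositional using (_⊎-↔_)
open import Data.Sum.Properties using (inj₁-injective; inj₂-injective)
open import Data.List using (List; _∷_; length; lookup; filter; take; tabulate; deduplicate; _++_)
open import Data.List.Properties using (length-++; length-take; length-tabulate; length-deduplicate)
open import Data.List.Membership.Propositional using (_∈_)
open import Data.List.Membership.Propositional.Properties
  using (∈-lookup; ∈-++⁺ˡ; ∈-++⁺ʳ; ∈-++⁻; ∈-tabulate⁺; ∈-tabulate⁻; ∈-filter⁺; ∈-filter⁻; ∈-deduplicate⁺; ∈-deduplicate⁻)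
import Data.List.Membership.DecPropositional as DecMembership
open import Data.List.Relation.Binary.Subset.Propositional using (_⊆_)
open import Data.List.Relation.Unary.All as All using ()
open import Data.List.Relation.Unary.AllPairs using (_∷_)
open import Data.List.Relation.Unary.Any using (here; there)
open import Data.List.Relation.Unary.Any.Properties using (lookup-index)
open import Data.List.Relation.Unary.Unique.Propositional using (Unique)
import Data.List.Relation.Unary.Unique.Propositional.Properties as Uniqueₚ
open import Data.List.Relation.Unary.Unique.DecPropositional.Properties using (deduplicate-!)
open import Function using (_∘_)
open import Function.Bundles using (_↔_; module Inverse; module Injection; module Equivalence)
open import Function.Properties.Inverse using (↔⇒↣; ↔-sym)
open import Function.Construct.Composition using () renaming (inverse to ↔-trans)
open import Function.Construct.Identity using (↔-id)
open import Function.Definitions using (Injective)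
open import Relation.Binary.Definitions using (DecidableEquality)
open import Relation.Binary.PropositionalEquality
open import Relation.Nullary using (yes; no; contradiction)

private variable
  A : Set

-- Counting in lists by injections, and padding to a given length.

-- The position of `f i` in `xs` determines `f i` and hence `i`, whether or not `xs` repeats
-- entries.
injective⇒≤-length : {k : ℕ} {xs : List A} {f : Fin k → A} → Injective _≡_ _≡_ f → (∀ i → f i ∈ xs) → k ≤ length xs
injective⇒≤-length {xs = xs} f-inj f∈xs = Finₚ.injective⇒≤ λ {i} {j} eq →
  f-inj (trans (lookup-index (f∈xs i)) (trans (cong (lookup xs) eq) (sym (lookup-index (f∈xs j)))))

lookup-injective : {xs : List A} → Unique xs → Injective _≡_ _≡_ (lookup xs)
lookup-injective (_ ∷ _)   {zero}  {zero}  _  = refl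
lookup-injective (x∉ ∷ _)  {zero}  {suc j} eq = contradiction eq (All.lookup x∉ (∈-lookup j))
lookup-injective (x∉ ∷ _)  {suc i} {zero}  eq = contradiction (sym eq) (All.lookup x∉ (∈-lookup i))
lookup-injective (_ ∷ xs!) {suc i} {suc j} eq = cong suc (lookup-injective xs! eq)

length-⊆ : {xs ys : List A} → Unique xs → xs ⊆ ys → length xs ≤ length ys
length-⊆ xs! xs⊆ys = injective⇒≤-length (lookup-injective xs!) (xs⊆ys ∘ ∈-lookup)

take-⊆ : ∀ m (xs : List A) → take m xs ⊆ xs
take-⊆ (suc m) (x ∷ xs) (here eq)  = here eq
take-⊆ (suc m) (x ∷ xs) (there x∈) = there (take-⊆ m xs x∈)

module _ (_≟_ : DecidableEquality A) where
  open DecMembership _≟_ using (_∈?_; _∉?_)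

  -- Used to pad the demands to exactly `p` pairs. Since `xs` may repeat entries, it is deduplicated
  -- first and then topped up with entries of `ys` outside it.
  intermediate : ∀ {xs ys p} → Unique ys → xs ⊆ ys → length xs ≤ p → p ≤ length ys →
    ∃[ zs ] Unique zs × length zs ≡ p × xs ⊆ zs × zs ⊆ ys
  intermediate {xs} {ys} {p} ys! xs⊆ys xs≤p p≤ys =
    us ++ vs , zs! , len , (λ x∈ → ∈-++⁺ˡ (∈-deduplicate⁺ _≟_ x∈)) , zs⊆ys
    where
    us ws vs : List A
    us = deduplicate _≟_ xs
    ws = filter (_∉? us) ys
    vs = take (p ∸ length us) ws

    vs⊆ws : vs ⊆ ws
    vs⊆ws = take-⊆ (p ∸ length us) ws

    zs! : Unique (us ++ vs)
    zs! = Uniqueₚ.++⁺ (deduplicate-! _≟_ xs) (Uniqueₚ.take⁺ _ (Uniqueₚ.filter⁺ (_∉? us) ys!))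
      λ (x∈us , x∈vs) → proj₂ (∈-filter⁻ (_∉? us) {xs = ys} (vs⊆ws x∈vs)) x∈us

    zs⊆ys : us ++ vs ⊆ ys
    zs⊆ys x∈ with ∈-++⁻ us x∈
    ... | inj₁ x∈us = xs⊆ys (∈-deduplicate⁻ _≟_ xs x∈us)
    ... | inj₂ x∈vs = proj₁ (∈-filter⁻ (_∉? us) {xs = ys} (vs⊆ws x∈vs))

    ys⊆ : ys ⊆ us ++ ws
    ys⊆ {y} y∈ with y ∈? us
    ... | yes y∈us = ∈-++⁺ˡ y∈us
    ... | no  y∉us = ∈-++⁺ʳ us (∈-filter⁺ (_∉? us) y∈ y∉us)

    us≤p : length us ≤ p
    us≤p = ≤-trans (length-deduplicate _≟_ xs) xs≤p

    rest≤ws : p ∸ length us ≤ length ws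
    -- `us` and `ws` together cover `ys`, which has at least `p` distinct entries.
    rest≤ws = m≤n+o⇒m∸n≤o p (length us)
      (≤-trans p≤ys (≤-trans (length-⊆ ys! ys⊆) (≤-reflexive (length-++ us))))

    len : length (us ++ vs) ≡ p
    len = begin
      length (us ++ vs)                              ≡⟨ length-++ us ⟩
      length us + length vs                          ≡⟨ cong (length us +_) (length-take _ ws) ⟩
      length us + (p ∸ length us) ⊓ length ws        ≡⟨ cong (length us +_) (m≤n⇒m⊓n≡m rest≤ws) ⟩
      length us + (p ∸ length us)                    ≡⟨ m+[n∸m]≡n us≤p ⟩
      p                                              ∎
      where open ≡-Reasoning

-- Walks, and the parabola of level increments.

Reach-path : ∀ {n} {E : List (Fin n × Fin n)} q (f : Fin (suc q) → Fin n) →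
  (∀ i → (f (inject₁ i) , f (suc i)) ∈ E) → Reach E (f zero) (f (fromℕ q))
Reach-path zero    f f∈E = here
Reach-path (suc q) f f∈E = there (f∈E zero) (Reach-path q (f ∘ suc) (f∈E ∘ suc))

-- The increase of the functional `y + 2ax` under one step in direction `b`.
cost : ℕ → ℕ → ℕ → ℕ
cost d a b = b * b + 2 * a * (d ∸ b)

-- Completing the square: b ↦ cost d a b is a parabola with apex a.
cost-parabola : ∀ {d a b} → a ≤ d → b ≤ d → cost d a b ≡ cost d a a + ∣ a - b ∣ * ∣ a - b ∣
cost-parabola {d} {a} {b} a≤d b≤d with ≤-total a b
... | inj₁ a≤b with m≤n⇒∃[o]m+o≡n a≤b | m≤n⇒∃[o]m+o≡n b≤d
...   | t , refl | c , refl
  rewrite m+n∸m≡n (a + t) c | +-assoc a t c | m+n∸m≡n a (t + c) | ∣m-m+n∣≡n a t = lemma a t c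
  where
  lemma : ∀ a t c → (a + t) * (a + t) + 2 * a * c ≡ a * a + 2 * a * (t + c) + t * t
  lemma = solve-∀
cost-parabola {d} {a} {b} a≤d b≤d | inj₂ b≤a with m≤n⇒∃[o]m+o≡n b≤a | m≤n⇒∃[o]m+o≡n a≤d
...   | t , refl | c , refl
  rewrite m+n∸m≡n (b + t) c | +-assoc b t c | m+n∸m≡n b (t + c) | ∣-∣-comm (b + t) b | ∣m-m+n∣≡n b t = lemma b t c
  where
  lemma : ∀ b t c → b * b + 2 * (b + t) * (t + c) ≡ (b + t) * (b + t) + 2 * (b + t) * c + t * t
  lemma = solve-∀

-- The excess over the apex is a square, so it vanishes only at `b = a`.
cost-min : ∀ {d a b} → a ≤ d → b ≤ d → cost d a b ≤ cost d a a → a ≡ b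
cost-min {d} {a} {b} a≤d b≤d ab≤aa = ∣m-n∣≡0⇒m≡n (sq0 ∣ a - b ∣ (+-cancelˡ-≤ (cost d a a) _ _ (begin
    cost d a a + ∣ a - b ∣ * ∣ a - b ∣  ≡⟨ cost-parabola a≤d b≤d ⟨
    cost d a b                           ≤⟨ ab≤aa ⟩
    cost d a a                           ≡⟨ +-identityʳ _ ⟨
    cost d a a + 0                       ∎)))
  where
  open ≤-Reasoning
  sq0 : ∀ t → t * t ≤ 0 → t ≡ 0
  sq0 zero _ = refl

cost-apex : ∀ {d a b} → a ≤ d → b ≤ d → cost d a a ≤ cost d a b
cost-apex {d} {a} {b} a≤d b≤d = ≤-trans (m≤m+n (cost d a a) _) (≤-reflexive (sym (cost-parabola a≤d b≤d)))

-- Core grid, tracks and sources.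

module Construction
  (d q m n s : ℕ)
  (sources-fit : d * (q * (d * d) + 2 * d * (q * d)) ≤ s)
  (nodes-fit : s + m * (suc q * ((q * d + q * d) * (q * (d * d) + q * (d * d)))) ≤ n)
  where

  -- Starts lie in an `X₀` by `Y₀` box; `X` and `Y` leave room for `q` steps of at most `d` and
  -- `d * d`. Every level of a start is below `Γ`.
  X₀ Y₀ X Y Γ : ℕ
  X₀ = q * d
  Y₀ = q * (d * d)
  X  = X₀ + q * d
  Y  = Y₀ + q * (d * d)
  Γ  = Y₀ + 2 * d * X₀

  Core Node Track : Set
  Core  = Fin m × Fin (suc q) × Fin X × Fin Y
  Node  = Fin s ⊎ Core
  Track = Fin m × Fin X₀ × Fin Y₀ × Fin d

  node↔ : Fin (s + m * (suc q * (X * Y))) ↔ Node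
  node↔ = ↔-trans Finₚ.+↔⊎ (↔-id _ ⊎-↔ ↔-trans Finₚ.*↔× (↔-id _ ×-↔ ↔-trans Finₚ.*↔× (↔-id _ ×-↔ Finₚ.*↔×)))

  track↔ : Fin (m * (X₀ * (Y₀ * d))) ↔ Track
  track↔ = ↔-trans Finₚ.*↔× (↔-id _ ×-↔ ↔-trans Finₚ.*↔× (↔-id _ ×-↔ Finₚ.*↔×))

  hop↔ : Fin (m * (X₀ * (Y₀ * d)) * q) ↔ (Track × Fin q)
  hop↔ = ↔-trans Finₚ.*↔× (track↔ ×-↔ ↔-id _)

  ⟦_⟧ : Node → Fin n
  ⟦ v ⟧ = inject≤ (Inverse.from node↔ v) nodes-fit

  ⟦⟧-injective : Injective _≡_ _≡_ ⟦_⟧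
  ⟦⟧-injective eq = Injection.injective (↔⇒↣ (↔-sym node↔)) (Finₚ.inject≤-injective nodes-fit nodes-fit _ _ eq)

  core-injective : ∀ u v → ⟦ inj₂ u ⟧ ≡ ⟦ inj₂ v ⟧ → u ≡ v
  core-injective u v eq = inj₂-injective (⟦⟧-injective {inj₂ u} {inj₂ v} eq)

  source-node-injective : ∀ σ ρ → ⟦ inj₁ σ ⟧ ≡ ⟦ inj₁ ρ ⟧ → σ ≡ ρ
  source-node-injective σ ρ eq = inj₁-injective (⟦⟧-injective {inj₁ σ} {inj₁ ρ} eq)

  source≢core : ∀ σ v → ⟦ inj₁ σ ⟧ ≢ ⟦ inj₂ v ⟧
  source≢core σ v eq with () ← ⟦⟧-injective {inj₁ σ} {inj₂ v} eq

  dx dy : Fin d → ℕ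
  dx b = d ∸ toℕ b
  dy b = toℕ b * toℕ b

  x<X : (x : Fin X₀) (i : Fin (suc q)) (b : Fin d) → toℕ x + toℕ i * dx b < X
  x<X x i b = +-mono-<-≤ (Finₚ.toℕ<n x) (*-mono-≤ (Finₚ.toℕ≤pred[n] i) (m∸n≤m d (toℕ b)))

  y<Y : (y : Fin Y₀) (i : Fin (suc q)) (b : Fin d) → toℕ y + toℕ i * dy b < Y
  y<Y y i b = +-mono-<-≤ (Finₚ.toℕ<n y) (*-mono-≤ (Finₚ.toℕ≤pred[n] i) (*-mono-≤ b≤d b≤d))
    where b≤d = <⇒≤ (Finₚ.toℕ<n b)

  point : Track → Fin (suc q) → Core
  point (j , x , y , b) i = j , i , fromℕ< (x<X x i b) , fromℕ< (y<Y y i b)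

  level : Fin d → ℕ → ℕ → ℕ
  level a x y = y + 2 * toℕ a * x

  level<Γ : (a : Fin d) (x : Fin X₀) (y : Fin Y₀) → level a (toℕ x) (toℕ y) < Γ
  level<Γ a x y = +-mono-<-≤ (Finₚ.toℕ<n y)
    (*-mono-≤ (*-monoʳ-≤ 2 (<⇒≤ (Finₚ.toℕ<n a))) (<⇒≤ (Finₚ.toℕ<n x)))

  -- Only the direction and the level enter, not the copy `j`: all copies share the sources, and
  -- `d * Γ` of them suffice.
  source : Track → Fin s
  source (j , x , y , a) = inject≤ (combine a (fromℕ< (level<Γ a x y))) sources-fit

  source-injective : ∀ {j j′ x x′ y y′ a b} → source (j , x , y , a) ≡ source (j′ , x′ , y′ , b) →
    a ≡ b × level a (toℕ x) (toℕ y) ≡ level a (toℕ x′) (toℕ y′)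
  source-injective {x = x} {x′} {y} {y′} {a} {b} eq
    with Finₚ.combine-injective a _ b _ (Finₚ.inject≤-injective sources-fit sources-fit _ _ eq)
  ... | refl , level≡ = refl , (begin
    level a (toℕ x) (toℕ y)            ≡⟨ Finₚ.toℕ-fromℕ< (level<Γ a x y) ⟨
    toℕ (fromℕ< (level<Γ a x y))       ≡⟨ cong toℕ level≡ ⟩
    toℕ (fromℕ< (level<Γ a x′ y′))     ≡⟨ Finₚ.toℕ-fromℕ< (level<Γ a x′ y′) ⟩
    level a (toℕ x′) (toℕ y′)          ∎)
    where open ≡-Reasoning

  entry : Track → Fin n × Fin n
  entry τ = ⟦ inj₁ (source τ) ⟧ , ⟦ inj₂ (point τ zero) ⟧

  hop : Track × Fin q → Fin n × Fin n
  hop (τ , i) = ⟦ inj₂ (point τ (inject₁ i)) ⟧ , ⟦ inj₂ (point τ (suc i)) ⟧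

  demand : Track → Fin n × Fin n
  demand τ = ⟦ inj₁ (source τ) ⟧ , ⟦ inj₂ (point τ (fromℕ q)) ⟧

  point-coords : ∀ {j j′ x x′ y y′ a b i} → point (j , x , y , a) i ≡ point (j′ , x′ , y′ , b) i →
    j ≡ j′ × toℕ x + toℕ i * dx a ≡ toℕ x′ + toℕ i * dx b × toℕ y + toℕ i * dy a ≡ toℕ y′ + toℕ i * dy b
  point-coords {x = x} {x′} {y} {y′} {a} {b} {i} eq with ,-injective eq
  ... | refl , eq₁ with ,-injective eq₁
  ... | refl , eq₂ with ,-injective eq₂
  ... | eqx , eqy = refl ,
    trans (sym (Finₚ.toℕ-fromℕ< (x<X x i a))) (trans (cong toℕ eqx) (Finₚ.toℕ-fromℕ< (x<X x′ i b))) ,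
    trans (sym (Finₚ.toℕ-fromℕ< (y<Y y i a))) (trans (cong toℕ eqy) (Finₚ.toℕ-fromℕ< (y<Y y′ i b)))

  -- Levels along a walk, and uniqueness of the walk to the end of a track.

  layer : Core → Fin (suc q)
  layer (_ , i , _) = i

  -- A walk that enters at level c stays Above, as a hop in direction b adds
  -- cost d a b ≥ cost d a a to the level; a track entered at level c meets the bound exactly.
  Above : Fin d → ℕ → Core → Set
  Above a c (_ , i , x , y) = c + toℕ i * cost d (toℕ a) (toℕ a) ≤ level a (toℕ x) (toℕ y)

  level-step : ∀ (a b : Fin d) x y k →
    level a (x + k * dx b) (y + k * dy b) ≡ level a x y + k * cost d (toℕ a) (toℕ b)
  level-step a b x y k = lemma (toℕ a) (dx b) (dy b) x y k
    where
    lemma : ∀ a u v x y k → (y + k * v) + 2 * a * (x + k * u) ≡ (y + 2 * a * x) + k * (v + 2 * a * u)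
    lemma = solve-∀

  level-point : ∀ (a : Fin d) j x y b i →
    let _ , _ , x′ , y′ = point (j , x , y , b) i in
    level a (toℕ x′) (toℕ y′) ≡ level a (toℕ x) (toℕ y) + toℕ i * cost d (toℕ a) (toℕ b)
  level-point a j x y b i = trans
    (cong₂ (level a) (Finₚ.toℕ-fromℕ< (x<X x i b)) (Finₚ.toℕ-fromℕ< (y<Y y i b)))
    (level-step a b (toℕ x) (toℕ y) (toℕ i))

  toℕ≤d : (a : Fin d) → toℕ a ≤ d
  toℕ≤d a = <⇒≤ (Finₚ.toℕ<n a)

  Edge : Fin n × Fin n → Set
  Edge e = (∃[ τ ] e ≡ entry τ) ⊎ (∃[ h ] e ≡ hop h)

  -- `E` is any list of entries and hops, so that the result applies to the edges of a preserver.
  module Uniqueness (E : List (Fin n × Fin n)) (E-edges : ∀ {e} → e ∈ E → Edge e)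
    (j : Fin m) (x : Fin X₀) (y : Fin Y₀) (a : Fin d) where

    τ : Track
    τ = j , x , y , a

    c aa : ℕ
    c = level a (toℕ x) (toℕ y)
    aa = cost d (toℕ a) (toℕ a)

    -- A walk that is not below the bound before a step and exactly on it afterwards has paid at
    -- most `aa` for that step, and only direction `a` is so cheap.
    same-direction : ∀ {b x′ y′} k →
      c + k * aa ≤ level a x′ y′ + k * cost d (toℕ a) (toℕ b) →
      level a x′ y′ + suc k * cost d (toℕ a) (toℕ b) ≡ c + suc k * aa → a ≡ b
    same-direction {b} {x′} {y′} k above end = Finₚ.toℕ-injective (cost-min (toℕ≤d a) (toℕ≤d b)
      (+-cancelˡ-≤ (c + k * aa) _ _ (begin
        c + k * aa + ab                    ≤⟨ +-monoˡ-≤ ab above ⟩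
        level a x′ y′ + k * ab + ab        ≡⟨ lemma (level a x′ y′) k ab ⟩
        level a x′ y′ + suc k * ab         ≡⟨ end ⟩
        c + suc k * aa                     ≡⟨ lemma c k aa ⟨
        c + k * aa + aa                    ∎)))
      where
      open ≤-Reasoning
      ab = cost d (toℕ a) (toℕ b)
      lemma : ∀ l k t → l + k * t + t ≡ l + (t + k * t)
      lemma = solve-∀

    above-track : ∀ j′ x′ y′ b (i : Fin q) → Above a c (point (j′ , x′ , y′ , b) (inject₁ i)) →
      c + toℕ i * aa ≤ level a (toℕ x′) (toℕ y′) + toℕ i * cost d (toℕ a) (toℕ b)
    above-track j′ x′ y′ b i above =
      subst (λ k → c + k * aa ≤ level a (toℕ x′) (toℕ y′) + k * cost d (toℕ a) (toℕ b)) (Finₚ.toℕ-inject₁ i)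
        (≤-trans above (≤-reflexive (level-point a j′ x′ y′ b (inject₁ i))))

    -- The meeting point lies exactly on the level bound, so the hop into it has direction `a`;
    -- stepping back by the same vector leads to the same start.
    backtrack : ∀ τ′ (i : Fin q) → Above a c (point τ′ (inject₁ i)) →
      point τ′ (suc i) ≡ point τ (suc i) → τ′ ≡ τ
    backtrack (j′ , x′ , y′ , b) i above eq with point-coords {x = x′} {x} {y′} {y} {b} {a} eq
    ... | refl , eqx , eqy = finish a≡b eqx eqy
      where
      k = toℕ i
      a≡b : a ≡ b
      a≡b = same-direction {b} {toℕ x′} {toℕ y′} k (above-track j′ x′ y′ b i above)
        (trans (sym (level-step a b (toℕ x′) (toℕ y′) (suc k)))
          (trans (cong₂ (level a) eqx eqy) (level-step a a (toℕ x) (toℕ y) (suc k))))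
      finish : a ≡ b → toℕ x′ + suc k * dx b ≡ toℕ x + suc k * dx a → toℕ y′ + suc k * dy b ≡ toℕ y + suc k * dy a →
        (j′ , x′ , y′ , b) ≡ τ
      finish refl eqx eqy
        with Finₚ.toℕ-injective (+-cancelʳ-≡ (suc k * dx a) (toℕ x′) (toℕ x) eqx)
           | Finₚ.toℕ-injective (+-cancelʳ-≡ (suc k * dy a) (toℕ y′) (toℕ y) eqy)
      ... | refl | refl = refl

    -- Induction on the walk. The bound `Above` is carried forward, while membership in `τ` comes
    -- back from the end: once the head of a hop lies on `τ`, `backtrack` identifies the hop as one
    -- of `τ`.
    forced : ∀ {u} v → u ≡ ⟦ inj₂ v ⟧ → Reach E u ⟦ inj₂ (point τ (fromℕ q)) ⟧ → Above a c v →
      v ≡ point τ (layer v) × (∀ i → toℕ (layer v) ≤ toℕ i → hop (τ , i) ∈ E)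
    forced v u≡ here above with core-injective (point τ (fromℕ q)) v u≡
    -- The end lies in layer `q`, where no hop remains.
    ... | refl = refl , λ i q≤i → contradiction (≤-trans (≤-reflexive (sym (Finₚ.toℕ-fromℕ q))) q≤i) (<⇒≱ (Finₚ.toℕ<n i))
    forced v u≡ (there e∈E r) above with E-edges e∈E
    -- Entries start at sources, so a walk inside the core can only continue by a hop.
    ... | inj₁ (τ′ , refl) = contradiction u≡ (source≢core (source τ′) v)
    ... | inj₂ ((τ′@(j′ , x′ , y′ , b) , i) , refl) with core-injective (point τ′ (inject₁ i)) v u≡
    ... | refl = conclude τ′≡τ
      where
      ab = cost d (toℕ a) (toℕ b)
      above′ : Above a c (point τ′ (suc i))
      above′ = begin
        c + (aa + toℕ i * aa)                         ≡⟨ lemma c aa (toℕ i * aa) ⟩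
        c + toℕ i * aa + aa                           ≤⟨ +-mono-≤ (above-track j′ x′ y′ b i above) (cost-apex (toℕ≤d a) (toℕ≤d b)) ⟩
        level a (toℕ x′) (toℕ y′) + toℕ i * ab + ab   ≡⟨ lemma (level a (toℕ x′) (toℕ y′)) ab (toℕ i * ab) ⟨
        level a (toℕ x′) (toℕ y′) + toℕ (suc i) * ab  ≡⟨ level-point a j′ x′ y′ b (suc i) ⟨
        _                                             ∎
        where
        open ≤-Reasoning
        lemma : ∀ l t u → l + (t + u) ≡ l + u + t
        lemma = solve-∀
      ih = forced (point τ′ (suc i)) refl r above′
      τ′≡τ : τ′ ≡ τ
      τ′≡τ = backtrack τ′ i above (proj₁ ih)
      conclude : τ′ ≡ τ → point τ′ (inject₁ i) ≡ point τ (inject₁ i) ×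
        (∀ i′ → toℕ (inject₁ i) ≤ toℕ i′ → hop (τ , i′) ∈ E)
      conclude refl = refl , later
        where
        later : ∀ i′ → toℕ (inject₁ i) ≤ toℕ i′ → hop (τ , i′) ∈ E
        later i′ i≤i′ with m≤n⇒m<n∨m≡n (subst (_≤ toℕ i′) (Finₚ.toℕ-inject₁ i) i≤i′)
        ... | inj₁ i<i′ = proj₂ ih i′ i<i′
        ... | inj₂ i≡i′ with Finₚ.toℕ-injective i≡i′
        ...   | refl = e∈E

    -- The first edge must be an entry with the source of `τ`, so it meets the level bound with
    -- equality. The start it enters may a priori differ from that of `τ`, even in its copy;
    -- `forced` handles every such start.
    hops-needed : ∀ {u} → u ≡ ⟦ inj₁ (source τ) ⟧ → Reach E u ⟦ inj₂ (point τ (fromℕ q)) ⟧ → ∀ i → hop (τ , i) ∈ E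
    hops-needed u≡ here i = contradiction (sym u≡) (source≢core (source τ) (point τ (fromℕ q)))
    hops-needed u≡ (there e∈E r) i with E-edges e∈E
    ... | inj₂ ((τ′ , i′) , refl) = contradiction (sym u≡) (source≢core (source τ) (point τ′ (inject₁ i′)))
    ... | inj₁ ((j′ , x′ , y′ , b) , refl)
      with source-injective {j} {j′} {x} {x′} {y} {y′} {a} {b} (sym (source-node-injective (source (j′ , x′ , y′ , b)) (source τ) u≡))
    ...   | refl , level≡ = proj₂ (forced (point (j′ , x′ , y′ , a) zero) refl r above) i z≤n
      where
      above : Above a c (point (j′ , x′ , y′ , a) zero)
      above = ≤-reflexive (trans (cong (_+ 0) level≡) (sym (level-point a j′ x′ y′ a zero)))

  -- Disjointness of the tracks, the graph and its padded demands.

  -- Tracks may cross in a node but share no hop: the layer gives `i`, the difference of the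
  -- x-coordinates gives the direction, and then the start follows.
  hop-injective : Injective _≡_ _≡_ hop
  hop-injective {τ@(j , x , y , a) , i} {τ′@(j′ , x′ , y′ , b) , i′} eq with ,-injective eq
  ... | eq₀ , eq₁ with Finₚ.inject₁-injective (cong layer (core-injective (point τ (inject₁ i)) (point τ′ (inject₁ i′)) eq₀))
  ... | refl with point-coords {x = x} {x′} {y} {y′} {a} {b} (core-injective (point τ (inject₁ i)) (point τ′ (inject₁ i)) eq₀)
                | point-coords {x = x} {x′} {y} {y′} {a} {b} (core-injective (point τ (suc i)) (point τ′ (suc i)) eq₁)
  ... | refl , x₀ , y₀ | _ , x₁ , _ = finish a≡b x₀ y₀
    where
    open ≡-Reasoning
    k = toℕ (inject₁ i)
    rotate : ∀ x t k → x + suc k * t ≡ x + k * t + t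
    rotate = solve-∀
    a≡b : a ≡ b
    a≡b = Finₚ.toℕ-injective (∸-cancelˡ-≡ (toℕ≤d a) (toℕ≤d b) (+-cancelˡ-≡ (toℕ x + k * dx a) _ _ (begin
      toℕ x + k * dx a + dx a     ≡⟨ rotate (toℕ x) (dx a) k ⟨
      toℕ x + suc k * dx a        ≡⟨ subst (λ l → toℕ x + suc l * dx a ≡ toℕ x′ + suc l * dx b) (sym (Finₚ.toℕ-inject₁ i)) x₁ ⟩
      toℕ x′ + suc k * dx b       ≡⟨ rotate (toℕ x′) (dx b) k ⟩
      toℕ x′ + k * dx b + dx b    ≡⟨ cong (_+ dx b) x₀ ⟨
      toℕ x + k * dx a + dx b     ∎)))
    finish : a ≡ b → toℕ x + k * dx a ≡ toℕ x′ + k * dx b → toℕ y + k * dy a ≡ toℕ y′ + k * dy b →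
      ((j , x , y , a) , i) ≡ ((j , x′ , y′ , b) , i)
    finish refl x₀ y₀
      with Finₚ.toℕ-injective (+-cancelʳ-≡ (k * dx a) (toℕ x) (toℕ x′) x₀)
         | Finₚ.toℕ-injective (+-cancelʳ-≡ (k * dy a) (toℕ y) (toℕ y′) y₀)
    ... | refl | refl = refl

  _≟ᴱ_ : DecidableEquality (Fin n × Fin n)
  _≟ᴱ_ = ≡-dec Finₚ._≟_ Finₚ._≟_

  allEntries allHops allEdges demands : List (Fin n × Fin n)
  allEntries = tabulate (entry ∘ Inverse.to track↔)
  allHops    = tabulate (hop ∘ Inverse.to hop↔)
  allEdges   = allEntries ++ allHops
  demands    = tabulate (demand ∘ Inverse.to track↔)

  graph : Digraph n
  graph = mkDigraph (deduplicate _≟ᴱ_ allEdges) (deduplicate-! _≟ᴱ_ allEdges)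

  graph-Edge : ∀ {e} → e ∈ edges graph → Edge e
  graph-Edge e∈ with ∈-++⁻ allEntries (∈-deduplicate⁻ _≟ᴱ_ allEdges e∈)
  ... | inj₁ e∈entries with i , refl ← ∈-tabulate⁻ e∈entries = inj₁ (Inverse.to track↔ i , refl)
  ... | inj₂ e∈hops    with i , refl ← ∈-tabulate⁻ e∈hops    = inj₂ (Inverse.to hop↔ i , refl)

  entry∈ : ∀ τ → entry τ ∈ edges graph
  entry∈ τ = ∈-deduplicate⁺ _≟ᴱ_ (∈-++⁺ˡ (subst (λ t → entry t ∈ allEntries) (Inverse.strictlyInverseˡ track↔ τ)
    (∈-tabulate⁺ (Inverse.from track↔ τ))))

  hop∈ : ∀ h → hop h ∈ edges graph
  hop∈ h = ∈-deduplicate⁺ _≟ᴱ_ (∈-++⁺ʳ allEntries (subst (λ t → hop t ∈ allHops) (Inverse.strictlyInverseˡ hop↔ h)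
    (∈-tabulate⁺ (Inverse.from hop↔ h))))

  demand∈ : ∀ τ → demand τ ∈ demands
  demand∈ τ = subst (λ t → demand t ∈ demands) (Inverse.strictlyInverseˡ track↔ τ) (∈-tabulate⁺ (Inverse.from track↔ τ))

  demand-reachable : ∀ τ → Reach (edges graph) (proj₁ (demand τ)) (proj₂ (demand τ))
  demand-reachable τ = there (entry∈ τ) (Reach-path q (λ i → ⟦ inj₂ (point τ i) ⟧) (λ i → hop∈ (τ , i)))

  -- A larger `P` only constrains `H` further, so padding the demands is harmless.
  preserver-size : ∀ {P} → demands ⊆ P → ∀ H → IsReachabilityPreserver graph P H →
    m * (X₀ * (Y₀ * d)) * q ≤ ∣E∣ H
  preserver-size demands⊆P H (H⊆G , H-preserves) = injective⇒≤-length {f = hop ∘ Inverse.to hop↔}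
    (λ {h} {h′} eq → Injection.injective (↔⇒↣ hop↔) (hop-injective {Inverse.to hop↔ h} {Inverse.to hop↔ h′} eq)) (λ i → hop∈H (Inverse.to hop↔ i))
    where
    hop∈H : ∀ h → hop h ∈ edges H
    hop∈H (τ@(j , x , y , a) , i) = Uniqueness.hops-needed (edges H) (graph-Edge ∘ All.lookup H⊆G) j x y a refl
      (Equivalence.from (H-preserves _ _ (demands⊆P (demand∈ τ))) (demand-reachable τ)) i

  sources : List (Fin n)
  sources = tabulate (⟦_⟧ ∘ inj₁)

  incident : Fin s × Fin n → Fin n × Fin n
  incident (σ , v) = ⟦ inj₁ σ ⟧ , v

  incident-injective : Injective _≡_ _≡_ incident
  incident-injective eq with ,-injective eq
  ... | eq₁ , refl with source-node-injective _ _ eq₁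
  ... | refl = refl

  allPairs : List (Fin n × Fin n)
  allPairs = tabulate (incident ∘ Inverse.to Finₚ.*↔×)

  allPairs! : Unique allPairs
  allPairs! = Uniqueₚ.tabulate⁺ (Injection.injective (↔⇒↣ Finₚ.*↔×) ∘ incident-injective)

  allPairs-sources : ∀ {e} → e ∈ allPairs → proj₁ e ∈ sources
  allPairs-sources e∈ with i , refl ← ∈-tabulate⁻ e∈ = ∈-tabulate⁺ _

  demands⊆allPairs : demands ⊆ allPairs
  demands⊆allPairs e∈ with i , refl ← ∈-tabulate⁻ e∈ =
    subst (λ t → incident t ∈ allPairs) (Inverse.strictlyInverseˡ Finₚ.*↔× (_ , _)) (∈-tabulate⁺ (Inverse.from (Finₚ.*↔× {s} {n}) _))

  hard-instance : ∀ {p} → m * (X₀ * (Y₀ * d)) ≤ p → p ≤ s * n →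
    Σ (Instance n s p) λ I → ∀ H → IsReachabilityPreserver (Instance.G I) (Instance.P I) H →
      m * (X₀ * (Y₀ * d)) * q ≤ ∣E∣ H
  hard-instance {p} demands≤p p≤sn
    with intermediate _≟ᴱ_ allPairs! demands⊆allPairs
           (subst (_≤ p) (sym (length-tabulate _)) demands≤p)
           (subst (p ≤_) (sym (length-tabulate _)) p≤sn)
  ... | P , P! , P-size , demands⊆P , P⊆ = record
    { G      = graph
    ; S      = sources
    ; S-uniq = Uniqueₚ.tabulate⁺ (source-node-injective _ _)
    ; S-size = length-tabulate _
    ; P      = P
    ; P-uniq = P!
    ; P-size = P-size
    ; P⊆S×V  = All.tabulate (allPairs-sources ∘ P⊆)
    } , preserver-size demands⊆P

-- Choice of the parameters and their estimates.

m<n+[m/n]*n : ∀ m n .{{_ : NonZero n}} → m < n + m / n * n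
m<n+[m/n]*n m n = begin-strict
  m                  ≡⟨ m≡m%n+[m/n]*n m n ⟩
  m % n + m / n * n  <⟨ +-monoˡ-< (m / n * n) (m%n<n m n) ⟩
  n + m / n * n      ∎
  where open ≤-Reasoning

-- In closed form `4d³q²(q + 1)` and `d⁴q²`. With `q` hops per track and `q ≥ 1`, a copy has at
-- least `d / 8` hops per node.
copySize trackCount : ℕ → ℕ → ℕ
copySize d q   = suc q * ((q * d + q * d) * (q * (d * d) + q * (d * d)))
trackCount d q = q * d * (q * (d * d) * d)

-- The first summand leaves room in p for all demands; the second forces 3d³ ≤ s.
density : ℕ → ℕ
density d = 6 * (d * d * d * (d * d * d) * d) + 9 * (d * d * d * (d * d * d))

-- The factor suc C in the bound on d makes a single copy of the core occupy at most n / 4 nodes.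
module Parameters {k C d n s p : ℕ}
  (d-large : 16 * suc k * suc C ≤ d)
  (s³≤Cn : s ^ 3 ≤ C * n)
  (dense : density d * n < p * s)
  (p≤sn : p ≤ s * n) where

  open ≤-Reasoning

  e : ℕ
  e = d * d * d

  dense-s² : density d * n < s * s * n
  dense-s² = begin-strict
    density d * n  <⟨ dense ⟩
    p * s            ≤⟨ *-monoˡ-≤ s p≤sn ⟩
    s * n * s        ≡⟨ lemma s n ⟩
    s * s * n        ∎
    where
    lemma : ∀ s n → s * n * s ≡ s * s * n
    lemma = solve-∀

  n>0 : 0 < n
  n>0 = n≢0⇒n>0 λ { refl → contradiction dense-s² (≤⇒≯ (≤-reflexive (trans (*-zeroʳ (s * s)) (sym (*-zeroʳ (density d)))))) }

  s-large : 3 * e ≤ s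
  s-large with 3 * e ≤? s
  ... | yes 3*e≤s = 3*e≤s
  ... | no  3*e≰s = contradiction dense-s² (≤⇒≯ (*-monoˡ-≤ n (begin
    s * s                ≤⟨ *-mono-≤ s≤ s≤ ⟩
    3 * e * (3 * e)      ≡⟨ lemma e ⟩
    9 * (e * e)          ≤⟨ m≤n+m (9 * (e * e)) (6 * (e * e * d)) ⟩
    density d          ∎)))
    where
    s≤ : s ≤ 3 * e
    s≤ = <⇒≤ (≰⇒> 3*e≰s)
    lemma : ∀ e → 3 * e * (3 * e) ≡ 9 * (e * e)
    lemma = solve-∀

  16C≤d : 16 * suc C ≤ d
  16C≤d = ≤-trans (*-monoˡ-≤ (suc C) (m≤m*n 16 (suc k))) d-large

  instance
    d≢0 : NonZero d
    d≢0 = >-nonZero (≤-trans z<s 16C≤d)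
    e≢0 : NonZero e
    e≢0 = m*n≢0 (d * d) d {{m*n≢0 d d}}
    3*e≢0 : NonZero (3 * e)
    3*e≢0 = m*n≢0 3 e
    s≢0 : NonZero s
    s≢0 = >-nonZero (≤-trans (>-nonZero⁻¹ (3 * e)) s-large)

  -- The sources needed number exactly `3 * e * q`, so this is the largest `q` for which they fit.
  q : ℕ
  q = s / (3 * e)

  instance
    q≢0 : NonZero q
    q≢0 = >-nonZero (m≥n⇒m/n>0 s-large)

  d≤e : d ≤ e
  d≤e = m≤n*m d (d * d) {{m*n≢0 d d}}

  16C≤s : 16 * suc C ≤ s
  16C≤s = ≤-trans 16C≤d (≤-trans d≤e (≤-trans (m≤n*m e 3) s-large))

  q3e≤s : q * (3 * e) ≤ s
  q3e≤s = m/n*n≤m s (3 * e)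

  -- Rounding down costs at most a factor two because `q` is at least one.
  s≤6eq : s ≤ 6 * e * q
  s≤6eq = begin
    s                          ≤⟨ <⇒≤ (m<n+[m/n]*n s (3 * e)) ⟩
    3 * e + q * (3 * e)        ≤⟨ +-monoˡ-≤ (q * (3 * e)) (m≤n*m (3 * e) q) ⟩
    q * (3 * e) + q * (3 * e)  ≡⟨ lemma e q ⟩
    6 * e * q                  ∎
    where
    lemma : ∀ e q → q * (3 * e) + q * (3 * e) ≡ 6 * e * q
    lemma = solve-∀

  -- Passing from `C` to `suc C` makes the factor nonzero, so that it can be cancelled below.
  sss≤Cn : s * s * s ≤ suc C * n
  sss≤Cn = begin
    s * s * s   ≡⟨ lemma s ⟩
    s ^ 3       ≤⟨ s³≤Cn ⟩
    C * n       ≤⟨ m≤n+m (C * n) n ⟩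
    suc C * n   ∎
    where
    lemma : ∀ s → s * s * s ≡ s * (s * (s * 1))
    lemma = solve-∀

  4s≤n : 4 * s ≤ n
  4s≤n = *-cancelˡ-≤ (suc C) (begin
    suc C * (4 * s)   ≡⟨ lemma (suc C) s ⟩
    4 * suc C * s     ≤⟨ *-monoˡ-≤ s (*-monoˡ-≤ (suc C) (m≤n+m 4 12)) ⟩
    16 * suc C * s    ≤⟨ *-monoˡ-≤ s 16C≤s ⟩
    s * s             ≤⟨ m≤m*n (s * s) s ⟩
    s * s * s         ≤⟨ sss≤Cn ⟩
    suc C * n         ∎)
    where
    lemma : ∀ c s → c * (4 * s) ≡ 4 * c * s
    lemma = solve-∀

  s≤n : s ≤ n
  s≤n = ≤-trans (m≤n*m s 4) 4s≤n

  W : ℕ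
  W = copySize d q

  W≡ : W ≡ 4 * (e * (q * q * suc q))
  W≡ = lemma d q (suc q)
    where
    lemma : ∀ d q r → r * ((q * d + q * d) * (q * (d * d) + q * (d * d))) ≡ 4 * (d * d * d * (q * q * r))
    lemma = solve-∀

  qqq≤W : q * q * q ≤ W
  qqq≤W = begin
    q * q * q                     ≤⟨ *-monoʳ-≤ (q * q) (n≤1+n q) ⟩
    q * q * suc q                 ≤⟨ m≤n*m (q * q * suc q) e ⟩
    e * (q * q * suc q)           ≤⟨ m≤n*m (e * (q * q * suc q)) 4 ⟩
    4 * (e * (q * q * suc q))     ≡⟨ W≡ ⟨
    W                             ∎

  W≤8eqqq : W ≤ 8 * (e * (q * q * q))
  W≤8eqqq = begin
    W                               ≡⟨ W≡ ⟩
    4 * (e * (q * q * suc q))       ≤⟨ *-monoʳ-≤ 4 (*-monoʳ-≤ e (*-monoʳ-≤ (q * q) (+-monoˡ-≤ q (>-nonZero⁻¹ q)))) ⟩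
    4 * (e * (q * q * (q + q)))     ≡⟨ lemma e q ⟩
    8 * (e * (q * q * q))           ∎
    where
    lemma : ∀ e q → 4 * (e * (q * q * (q + q))) ≡ 8 * (e * (q * q * q))
    lemma = solve-∀

  instance
    qqq≢0 : NonZero (q * q * q)
    qqq≢0 = m*n≢0 (q * q) q {{m*n≢0 q q}}
    W≢0 : NonZero W
    W≢0 = >-nonZero (≤-trans (>-nonZero⁻¹ (q * q * q)) qqq≤W)

  -- A copy has at most `8eq³` nodes, while `s³` is at least `27e³q³`. The surplus in powers of `e`
  -- absorbs the constants and `suc C`, as `16 * suc C ≤ d ≤ e`.
  4W≤n : 4 * W ≤ n
  4W≤n = *-cancelˡ-≤ (suc C) (begin
    suc C * (4 * W)                          ≤⟨ *-monoʳ-≤ (suc C) (*-monoʳ-≤ 4 W≤8eqqq) ⟩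
    suc C * (4 * (8 * (e * (q * q * q))))    ≡⟨ lemma₁ (suc C) e q ⟩
    16 * suc C * (2 * (e * (q * q * q)))     ≤⟨ *-monoˡ-≤ (2 * (e * (q * q * q))) (≤-trans 16C≤d d≤e) ⟩
    e * (2 * (e * (q * q * q)))              ≤⟨ *-monoʳ-≤ e (*-monoˡ-≤ (e * (q * q * q)) (≤-trans (m≤n+m 2 25) (m≤m*n 27 e))) ⟩
    e * (27 * e * (e * (q * q * q)))         ≡⟨ lemma₂ e q ⟩
    q * (3 * e) * (q * (3 * e)) * (q * (3 * e)) ≤⟨ *-mono-≤ (*-mono-≤ q3e≤s q3e≤s) q3e≤s ⟩
    s * s * s                                ≤⟨ sss≤Cn ⟩
    suc C * n                                ∎)
    where
    lemma₁ : ∀ c e q → c * (4 * (8 * (e * (q * q * q)))) ≡ 16 * c * (2 * (e * (q * q * q)))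
    lemma₁ = solve-∀
    lemma₂ : ∀ e q → e * (27 * e * (e * (q * q * q))) ≡ q * (3 * e) * (q * (3 * e)) * (q * (3 * e))
    lemma₂ = solve-∀

  m : ℕ
  m = (n ∸ s) / W

  sources-fit : d * (q * (d * d) + 2 * d * (q * d)) ≤ s
  sources-fit = ≤-trans (≤-reflexive (lemma d q)) q3e≤s
    where
    lemma : ∀ d q → d * (q * (d * d) + 2 * d * (q * d)) ≡ q * (3 * (d * d * d))
    lemma = solve-∀

  mW≤n∸s : m * W ≤ n ∸ s
  mW≤n∸s = m/n*n≤m (n ∸ s) W

  nodes-fit : s + m * W ≤ n
  nodes-fit = ≤-trans (+-monoʳ-≤ s mW≤n∸s) (≤-reflexive (m+[n∸m]≡n s≤n))

  -- The sources take at most `n / 4` nodes and an incomplete last copy wastes at most another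
  -- `n / 4`.
  n≤2mW : n ≤ 2 * (m * W)
  -- The claim is doubled and `n + n` is added to both sides, to pay for `4 * s` and `4 * W` without
  -- subtraction.
  n≤2mW = *-cancelˡ-≤ 2 (+-cancelˡ-≤ (n + n) _ _ (begin
    n + n + 2 * n                       ≡⟨ lemma₁ n ⟩
    4 * n                               ≡⟨ cong (4 *_) (m+[n∸m]≡n s≤n) ⟨
    4 * (s + (n ∸ s))                   ≤⟨ *-monoʳ-≤ 4 (+-monoʳ-≤ s (<⇒≤ (m<n+[m/n]*n (n ∸ s) W))) ⟩
    4 * (s + (W + m * W))               ≡⟨ lemma₂ s W (m * W) ⟩
    4 * s + 4 * W + 2 * (2 * (m * W))   ≤⟨ +-monoˡ-≤ (2 * (2 * (m * W))) (+-mono-≤ 4s≤n 4W≤n) ⟩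
    n + n + 2 * (2 * (m * W))           ∎))
    where
    lemma₁ : ∀ n → n + n + 2 * n ≡ 4 * n
    lemma₁ = solve-∀
    lemma₂ : ∀ s w t → 4 * (s + (w + t)) ≡ 4 * s + 4 * w + 2 * (2 * t)
    lemma₂ = solve-∀

  -- Multiplied by `s ≤ 6eq`, the number of tracks becomes `6e²d` times `m * q³`, and
  -- `m * q³ ≤ m * W ≤ n`.
  tracks≤p : m * trackCount d q ≤ p
  tracks≤p = *-cancelʳ-≤ _ _ s (begin
    m * trackCount d q * s             ≤⟨ *-monoʳ-≤ (m * trackCount d q) s≤6eq ⟩
    m * trackCount d q * (6 * e * q)   ≡⟨ lemma d q m ⟩
    6 * (e * e * d) * (m * (q * q * q)) ≤⟨ *-monoʳ-≤ (6 * (e * e * d)) (≤-trans (*-monoʳ-≤ m qqq≤W) (≤-trans mW≤n∸s (m∸n≤m n s))) ⟩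
    6 * (e * e * d) * n                ≤⟨ *-monoˡ-≤ n (m≤m+n (6 * (e * e * d)) (9 * (e * e))) ⟩
    density d * n                    ≤⟨ <⇒≤ dense ⟩
    p * s                              ∎)
    where
    lemma : ∀ d q m → m * (q * d * (q * (d * d) * d)) * (6 * (d * d * d) * q) ≡ 6 * (d * d * d * (d * d * d) * d) * (m * (q * q * q))
    lemma = solve-∀

  -- From `n ≤ 2mW ≤ 16meq³` it follows that `d * n` is at most 16 times the number of hops; the
  -- factor `16 * suc k` in `d` pays for this.
  hops-large : k * n < m * trackCount d q * q
  hops-large = *-cancelˡ-< 16 _ _ (begin-strict
    16 * (k * n)                            ≡⟨ *-assoc 16 k n ⟨
    16 * k * n                              <⟨ *-monoˡ-< n {{>-nonZero n>0}} (*-monoʳ-< 16 (n<1+n k)) ⟩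
    16 * suc k * n                          ≤⟨ *-monoˡ-≤ n (≤-trans (m≤m*n (16 * suc k) (suc C)) d-large) ⟩
    d * n                                   ≤⟨ *-monoʳ-≤ d n≤2mW ⟩
    d * (2 * (m * W))                       ≤⟨ *-monoʳ-≤ d (*-monoʳ-≤ 2 (*-monoʳ-≤ m W≤8eqqq)) ⟩
    d * (2 * (m * (8 * (e * (q * q * q))))) ≡⟨ lemma d q m ⟩
    16 * (m * trackCount d q * q)           ∎)
    where
    lemma : ∀ d q m → d * (2 * (m * (8 * (d * d * d * (q * q * q))))) ≡ 16 * (m * (q * d * (q * (d * d) * d)) * q)
    lemma = solve-∀

-- Superlinearity along a sparse sequence of node counts.

module _ (p s : ℕ → ℕ)
  (s-small : ∃[ C ] ∃[ N ] ∀ n → N ≤ n → s n ^ 3 ≤ C * n)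
  (ps-dense : ∀ C → ∃[ N ] ∀ n → N ≤ n → C * n < p n * s n)
  (p-fits : ∃[ N ] ∀ n → N ≤ n → p n ≤ s n * n) where

  Hard : ℕ → ℕ → Set
  Hard k n = Σ (Instance n (s n) (p n)) λ I → ∀ H →
    IsReachabilityPreserver (Instance.G I) (Instance.P I) H → k * n < ∣E∣ H

  eventually-hard : ∀ k → ∃[ N ] ∀ n → N ≤ n → Hard k n
  eventually-hard k = N , hard
    where
    C = proj₁ s-small
    -- The least value `Parameters` admits. It does not depend on `n`, so `ps-dense` may be applied
    -- to the constant `density d`.
    d = 16 * suc k * suc C
    N₁ = proj₁ (proj₂ s-small)
    N₂ = proj₁ (ps-dense (density d))
    N₃ = proj₁ p-fits
    N = N₁ ⊔ (N₂ ⊔ N₃)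
    hard : ∀ n → N ≤ n → Hard k n
    hard n N≤n =
      let p≤sn = proj₂ p-fits n (m⊔n≤o⇒n≤o N₂ N₃ N₂⊔N₃≤n)
          module Π = Parameters {k} {C} {d} {n} {s n} {p n} ≤-refl
            (proj₂ (proj₂ s-small) n (m⊔n≤o⇒m≤o N₁ (N₂ ⊔ N₃) N≤n))
            (proj₂ (ps-dense (density d)) n (m⊔n≤o⇒m≤o N₂ N₃ N₂⊔N₃≤n))
            p≤sn
          I , size = Construction.hard-instance d Π.q Π.m n (s n) Π.sources-fit Π.nodes-fit Π.tracks≤p p≤sn
      in I , λ H preserver → <-≤-trans Π.hops-large (size H preserver)
      where
      N₂⊔N₃≤n : N₂ ⊔ N₃ ≤ n
      N₂⊔N₃≤n = m⊔n≤o⇒n≤o N₁ (N₂ ⊔ N₃) N≤n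

  threshold : ℕ → ℕ
  threshold k = proj₁ (eventually-hard k)

  -- Adding strict growth to the thresholds makes the index `k` recoverable from the node count.
  size : ℕ → ℕ
  size zero    = threshold zero
  size (suc k) = suc (size k) ⊔ threshold (suc k)

  threshold≤size : ∀ k → threshold k ≤ size k
  threshold≤size zero    = ≤-refl
  threshold≤size (suc k) = m≤n⊔m (suc (size k)) (threshold (suc k))

  size-< : ∀ k → size k < size (suc k)
  size-< k = m≤m⊔n (suc (size k)) (threshold (suc k))

  size-mono-< : ∀ {i j} → i < j → size i < size j
  size-mono-< {i} {suc j} i<1+j with m<1+n⇒m<n∨m≡n i<1+j
  ... | inj₁ i<j  = <-trans (size-mono-< i<j) (size-< j)
  ... | inj₂ refl = size-< j

  k≤size : ∀ k → k ≤ size k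
  k≤size zero    = z≤n
  k≤size (suc k) = ≤-<-trans (k≤size k) (size-< k)

  hard-at-size : ∀ k → Hard k (size k)
  hard-at-size k = proj₂ (eventually-hard k) (size k) (threshold≤size k)

theorem8 : (p s : ℕ → ℕ)
    → (∃[ C ] ∃[ N ] ∀ n → N ≤ n → s n ^ 3 ≤ C * n)
    → (∀ C → ∃[ N ] ∀ n → N ≤ n → C * n < p n * s n)
    → (∃[ N ] ∀ n → N ≤ n → p n ≤ s n * n)
    → Σ (ℕ → Set) λ Family
    → (∀ N → ∃[ n ] (N ≤ n × Family n))
    × Σ (∀ n → Family n → Instance n (s n) (p n)) λ inst
    → ∀ C → ∃[ N ] ∀ n → (fn : Family n) → N ≤ n
    → ∀ (H : Digraph n)
    → IsReachabilityPreserver (Instance.G (inst n fn)) (Instance.P (inst n fn)) H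
    → C * n < ∣E∣ H
theorem8 p s s-small ps-dense p-fits =
  -- The node count `ν N` is a member beyond `N`, and `ν C` is the threshold for the factor `C`.
  Family , (λ N → ν N , k≤size p s s-small ps-dense p-fits N , N , refl) , inst , λ C → ν C , bound C
  where
  ν : ℕ → ℕ
  ν = size p s s-small ps-dense p-fits

  Family : ℕ → Set
  Family n = ∃[ k ] n ≡ ν k

  hard : ∀ k → Hard p s s-small ps-dense p-fits k (ν k)
  hard = hard-at-size p s s-small ps-dense p-fits

  inst : ∀ n → Family n → Instance n (s n) (p n)
  inst _ (k , refl) = proj₁ (hard k)

  bound : ∀ C n (fn : Family n) → ν C ≤ n → ∀ H →
    IsReachabilityPreserver (Instance.G (inst n fn)) (Instance.P (inst n fn)) H → C * n < ∣E∣ H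
  -- The instance on `ν k` nodes beats the factor `k`, and strict growth of `ν` turns `ν C ≤ ν k`
  -- into `C ≤ k`.
  bound C _ (k , refl) νC≤νk H preserver = ≤-<-trans (*-monoˡ-≤ (ν k) C≤k) (proj₂ (hard k) H preserver)
    where
    C≤k : C ≤ k
    C≤k = ≮⇒≥ λ k<C → <⇒≱ (size-mono-< p s s-small ps-dense p-fits k<C) νC≤νk
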